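{- Let $G$ be a graph such that (i) the triadic dual $T_{3}(G)$ is connected, and (ii) every edge of $G$ is part of at most two triangles, and let $s_{0}:E(G)\rightarrow \{\pm 1\}$ be an initial state of the nondeterministic triad dynamics. Then: 1. If $G$ contains an edge that is part of only one triangle, the recurrent states of the dynamics started at $s_0$ are exactly the completely balanced states (no imbalanced triangle) reachable from $s_{0}$. 2. If every edge of $G$ is part of exactly two triangles and the number of imbalanced triangles in $s_{0}$ is even, the recurrent states are exactly the completely balanced states reachable from $s_{0}$. 3. If every edge of $G$ is part of exactly two triangles and the number of imbalanced triangles in $s_{0}$ is odd, the recurrent states are the states (reachable from $s_0$) containing exactly one imbalanced triangle.
   Context: A state is a labeling of the edges of $G$ by $\pm 1$. A triangle is balanced if the product of its three edge labels is $1$, imbalanced otherwise. Nondeterministic triad dynamics: at each step, for some imbalanced triangle $T$, the sign of an arbitrary edge of $T$ is changed. A state is reachable from another if it can be obtained by a finite sequence of such moves. A state $s$ is recurrent (for the dynamics started at $s_0$) if for every infinite path $\pi=(\pi_0=s_0,\pi_1,\ldots)$ of the system and every $n$, $s$ is reachable from $\pi_n$. The triadic dual $T_3(G)$ has the triangles of $G$ as vertices, with, for each edge $e$ of $G$, a hyperedge consisting of all triangles containing $e$ (a self-loop if $e$ lies in a single triangle).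
   Formalization: Recurrent here means: reachable from s₀ and, on every infinite path from s₀ (staying put once balanced), reachable at all times after s is visited. With the literal definition items 1 and 2 fail for a single imbalanced triangle; item 3 is proved for both. -}

module Defs where

open import Level using (0ℓ)
open import Data.Nat.Base using (ℕ; suc; _≤_)
open import Data.Fin.Base using (Fin; zero; suc; _<_)
import Data.Fin.Properties as Fin
open import Data.List.Base using (List; []; _∷_; length; filter; mapMaybe; cartesianProduct; allFin)
open import Data.List.Membership.Propositional using (_∈_)
open import Data.List.Membership.Propositional.Properties using (∈-allFin; ∈-cartesianProduct⁺)
open import Data.List.Relation.Unary.All using (All; []; _∷_)
open import Data.List.Relation.Unary.AllPairs using ([]; _∷_)
import Data.List.Relation.Unary.Any as Any
import Data.List.Relation.Unary.Any.Properties as Any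
open import Data.List.Relation.Unary.Unique.Propositional using (Unique)
open import Data.List.Relation.Unary.Unique.Propositional.Properties using (allFin⁺; cartesianProduct⁺)
open import Data.Maybe.Base using (Maybe; just; nothing)
import Data.Maybe.Relation.Unary.Any as MAny
open import Data.Product.Base using (_×_; _,_; ∃-syntax)
open import Data.Sign.Base using (Sign; +; opposite; _*_)
import Data.Sign.Properties as Sign
open import Data.Sum.Base using (_⊎_)
open import Relation.Binary.Core using (Rel)
open import Relation.Binary.Definitions using (Decidable; DecidableEquality; Irreflexive; Symmetric)
open import Relation.Binary.Construct.Closure.ReflexiveTransitive using (Star)
open import Relation.Binary.PropositionalEquality using (_≡_; _≢_; _≗_; refl; sym; trans)
open import Relation.Nullary.Decidable using (yes; no; ¬?; _×-dec_; map′)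
open import Relation.Nullary.Negation using (¬_; contradiction-irr)

record Graph : Set₁ where
  field
    order    : ℕ
    _~_      : Rel (Fin order) 0ℓ
    _~?_     : Decidable _~_
    ~-sym    : Symmetric _~_
    ~-irrefl : Irreflexive _≡_ _~_

  Vertex : Set
  Vertex = Fin order

-- Hyperedges may have any number of members; one with a single member is a self-loop.
record Hypergraph : Set₁ where
  field
    Node      : Set
    Hyperedge : Set
    _∈ʰ_      : Node → Hyperedge → Set

-- The hypergraph with no nodes counts as connected.
Connected : Hypergraph → Set
Connected H = ∀ x y → Star (λ u v → ∃[ h ] (u ∈ʰ h × v ∈ʰ h)) x y
  where open Hypergraph H

module _ (G : Graph) where
  open Graph G

  -- An unordered pair or triple of vertices is listed in increasing order. The proofs are
  -- irrelevant, so that _≡_ on edges and on triangles is equality of vertex sets.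
  record Edge : Set where
    constructor edge
    field
      i j    : Vertex
      .i<j   : i < j
      .i~j   : i ~ j

  record Triangle : Set where
    constructor triangle
    field
      i j k         : Vertex
      .i<j          : i < j
      .j<k          : j < k
      .i~j          : i ~ j
      .j~k          : j ~ k
      .i~k          : i ~ k

module _ {G : Graph} where
  open Graph G

  _≟ᵉ_ : DecidableEquality (Edge G)
  edge i j _ _ ≟ᵉ edge k l _ _ =
    map′ (λ { (refl , refl) → refl }) (λ { refl → refl , refl }) (i Fin.≟ k ×-dec j Fin.≟ l)

  side : Triangle G → Fin 3 → Edge G
  side (triangle i j k i<j j<k i~j j~k i~k) zero             = edge i j i<j i~j
  side (triangle i j k i<j j<k i~j j~k i~k) (suc zero)       = edge j k j<k j~k
  side (triangle i j k i<j j<k i~j j~k i~k) (suc (suc zero)) = edge i k (Fin.<-trans i<j j<k) i~k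

  _∈ᵗ_ : Edge G → Triangle G → Set
  e ∈ᵗ T = ∃[ a ] side T a ≡ e

  _∈ᵗ?_ : Decidable _∈ᵗ_
  e ∈ᵗ? T = Fin.any? (λ a → side T a ≟ᵉ e)

module _ (G : Graph) where
  open Graph G

  T₃ : Hypergraph
  T₃ = record { Node = Triangle G ; Hyperedge = Edge G ; _∈ʰ_ = λ T e → e ∈ᵗ T }

  toTriangle : Vertex × Vertex × Vertex → Maybe (Triangle G)
  toTriangle (i , j , k)
    with i Fin.<? j ×-dec j Fin.<? k ×-dec i ~? j ×-dec j ~? k ×-dec i ~? k
  ... | yes (i<j , j<k , i~j , j~k , i~k) = just (triangle i j k i<j j<k i~j j~k i~k)
  ... | no _                              = nothing

  triples : List (Vertex × Vertex × Vertex)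
  triples = cartesianProduct (allFin order) (cartesianProduct (allFin order) (allFin order))

  triangles : List (Triangle G)
  triangles = mapMaybe toTriangle triples

  private
    vertices : Triangle G → Vertex × Vertex × Vertex
    vertices (triangle i j k _ _ _ _ _) = i , j , k

    toTriangle-vertices : ∀ T → MAny.Any (T ≡_) (toTriangle (vertices T))
    toTriangle-vertices (triangle i j k i<j j<k i~j j~k i~k)
      with i Fin.<? j ×-dec j Fin.<? k ×-dec i ~? j ×-dec j ~? k ×-dec i ~? k
    ... | yes _ = MAny.just refl
    ... | no ¬p = contradiction-irr (i<j , j<k , i~j , j~k , i~k) ¬p

    toTriangle-injective : ∀ {T} v → toTriangle v ≡ just T → vertices T ≡ v
    toTriangle-injective (i , j , k) eq
      with i Fin.<? j ×-dec j Fin.<? k ×-dec i ~? j ×-dec j ~? k ×-dec i ~? k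
    toTriangle-injective (i , j , k) refl | yes _ = refl

  ∈-triangles : ∀ T → T ∈ triangles
  ∈-triangles T = Any.mapMaybe⁺ toTriangle triples
    (Any.map⁺ (Any.map (λ { refl → toTriangle-vertices T }) (∈-triples (vertices T))))
    where
    ∈-triples : ∀ v → v ∈ triples
    ∈-triples (i , j , k) =
      ∈-cartesianProduct⁺ (∈-allFin i) (∈-cartesianProduct⁺ (∈-allFin j) (∈-allFin k))

  triangles-unique : Unique triangles
  triangles-unique = go triples
    (cartesianProduct⁺ (allFin⁺ order) (cartesianProduct⁺ (allFin⁺ order) (allFin⁺ order)))
    where
    fresh : ∀ {v T} vs → vertices T ≡ v → All (v ≢_) vs → All (T ≢_) (mapMaybe toTriangle vs)
    fresh []       _  []        = []
    fresh (w ∷ vs) eq (v≢w ∷ p) with toTriangle w in eq′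
    ... | nothing = fresh vs eq p
    ... | just _  = (λ { refl → v≢w (trans (sym eq) (toTriangle-injective w eq′)) }) ∷ fresh vs eq p

    go : ∀ vs → Unique vs → Unique (mapMaybe toTriangle vs)
    go []       []      = []
    go (v ∷ vs) (p ∷ u) with toTriangle v in eq
    ... | nothing = go vs u
    ... | just _  = fresh vs (toTriangle-injective v eq) p ∷ go vs u

  State : Set
  State = Edge G → Sign

module _ {G : Graph} where

  #trianglesAt : Edge G → ℕ
  #trianglesAt e = length (filter (e ∈ᵗ?_) (triangles G))

  Balanced : State G → Triangle G → Set
  Balanced s T = s (side T zero) * s (side T (suc zero)) * s (side T (suc (suc zero))) ≡ +

  Imbalanced : State G → Triangle G → Set
  Imbalanced s T = ¬ Balanced s T

  imbalanced? : Decidable Imbalanced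
  imbalanced? s T = ¬? (_ Sign.≟ +)

  #imbalanced : State G → ℕ
  #imbalanced s = length (filter (imbalanced? s) (triangles G))

  CompletelyBalanced : State G → Set
  CompletelyBalanced s = ∀ T → Balanced s T

  FlipsAt : Edge G → Rel (State G) 0ℓ
  FlipsAt e s t = t e ≡ opposite (s e) × (∀ e′ → e′ ≢ e → t e′ ≡ s e′)

  Move : Rel (State G) 0ℓ
  Move s t = ∃[ T ] ∃[ e ] (Imbalanced s T × e ∈ᵗ T × FlipsAt e s t)

  -- States are functions, so they are compared pointwise.
  Reachable : Rel (State G) 0ℓ
  Reachable s t = ∃[ u ] (Star Move s u × u ≗ t)

  -- No move is possible from a completely balanced state; the dynamics stays there forever.
  Step : Rel (State G) 0ℓ
  Step s t = Move s t ⊎ (CompletelyBalanced s × s ≗ t)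

  InfinitePath : State G → (ℕ → State G) → Set
  InfinitePath s₀ π = π 0 ≗ s₀ × (∀ n → Step (π n) (π (suc n)))

  -- Return to s is required from the moment a path has visited s, as is usual for
  -- recurrence. Without this proviso no state would be recurrent as soon as two distinct
  -- completely balanced states can be reached from s₀, since neither can be left: if G is
  -- a single imbalanced triangle, each of its three flips leads to one.
  Recurrent : Rel (State G) 0ℓ
  Recurrent s₀ s = Reachable s₀ s ×
    (∀ π → InfinitePath s₀ π → ∀ m n → m ≤ n → π m ≗ s → Reachable (π n) s)

  -- The stronger notion, without the proviso.
  UnavoidablyRecurrent : Rel (State G) 0ℓ
  UnavoidablyRecurrent s₀ s = ∀ π → InfinitePath s₀ π → ∀ n → Reachable (π n) s

{-# OPTIONS --safe #-}

-- Flipping a side of an imbalanced triangle passes the imbalance on to the other triangle containing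
-- that side: if that one was imbalanced too, the two imbalances annihilate, and if there is none, the
-- imbalance disappears. An imbalance can thus be carried along any walk in the triadic dual, to an edge
-- lying in a single triangle or to another imbalance, until at most one imbalance is left. When every
-- edge lies in two triangles, the parity of the number of imbalances is invariant, and any state u with
-- a single imbalance can be turned into any other such state s: let the imbalance of u cross an edge at
-- which u and s differ; if there is no such edge at hand, first carry the imbalances of both u and s
-- along the same walk to one, which changes the same signs in u and in s and is reversible.

module Submission where

open import Level using (Level)
open import Data.Nat.Base
  using (ℕ; zero; suc; _≤_; _<_; _≤′_; ≤′-reflexive; ≤′-step; _+_; z≤n; s≤s; z<s)
import Data.Nat.Properties as ℕ
open import Data.Nat.Induction using (<-wellFounded)
open import Data.Nat.Divisibility
  using (_∣_; _∤_; _∣0; ∣m∣n⇒∣m+n; ∣m+n∣m⇒∣n; ∣-refl; ∣1⇒≡1; m∣m*n)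
open import Data.Nat.Tactic.RingSolver using (solve-∀)
open import Data.Fin.Base using (Fin; zero; suc)
import Data.Fin.Properties as Fin
open import Data.List.Base using (List; []; _∷_; length; filter; cartesianProductWith; allFin)
open import Data.List.Properties using (filter-notAll; filter-some)
open import Data.List.Membership.Propositional using (_∈_; find; lose)
open import Data.List.Membership.Propositional.Properties
  using (∈-filter⁺; ∈-filter⁻; ∈-allFin; ∈-cartesianProductWith⁺)
open import Data.List.Relation.Binary.Subset.Propositional using (_⊆_)
open import Data.List.Relation.Unary.All as All using (All; []; _∷_)
open import Data.List.Relation.Unary.AllPairs using ([]; _∷_)
open import Data.List.Relation.Unary.Any as Any using (Any; here; there)
open import Data.List.Relation.Unary.Unique.Propositional using (Unique)
import Data.List.Relation.Unary.Unique.Propositional.Properties as Unique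
open import Data.Product.Base using (_×_; _,_; proj₁; proj₂; ∃-syntax)
open import Data.Sign.Base using (Sign; opposite; _*_) renaming (+ to ⊕; - to ⊖)
import Data.Sign.Properties as Sign
open import Data.Sum.Base using (_⊎_; inj₁; inj₂)
open import Function.Base using (_∘_)
open import Function.Bundles using (_⇔_; mk⇔; Equivalence)
open import Function.Construct.Composition using (_⇔-∘_)
open import Induction.WellFounded using (Acc; acc)
open import Relation.Binary.Construct.Closure.ReflexiveTransitive using (Star; ε; _◅_; _◅◅_)
open import Relation.Binary.Core using (Rel)
open import Relation.Binary.Definitions using (DecidableEquality)
open import Relation.Binary.PropositionalEquality
  using (_≡_; _≢_; _≗_; refl; sym; trans; cong; cong-app; cong₂; subst; subst₂; module ≡-Reasoning)
open import Relation.Nullary.Decidable using (yes; no; ¬?; _×-dec_; map′; decidable-stable)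
open import Relation.Nullary.Negation using (¬_; contradiction; contradiction-irr)
open import Relation.Unary using (Pred; Decidable)
open import Defs

private
  variable
    a p q : Level
    A : Set a

-- Counting in lists

module _ {P : Pred A p} {Q : Pred A q} (P? : Decidable P) (Q? : Decidable Q) where

  length-filter-mono : (∀ {x} → P x → Q x) → ∀ xs → length (filter P? xs) ≤ length (filter Q? xs)
  length-filter-mono P⇒Q []       = z≤n
  length-filter-mono P⇒Q (x ∷ xs) with P? x | Q? x
  ... | yes _  | yes _  = s≤s (length-filter-mono P⇒Q xs)
  ... | yes px | no ¬qx = contradiction (P⇒Q px) ¬qx
  ... | no _   | yes _  = ℕ.m≤n⇒m≤1+n (length-filter-mono P⇒Q xs)
  ... | no _   | no _   = length-filter-mono P⇒Q xs

  length-filter-mono-< : (∀ {x} → P x → Q x) → ∀ {x xs} → x ∈ xs → Q x → ¬ P x →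
                         length (filter P? xs) < length (filter Q? xs)
  length-filter-mono-< P⇒Q {x} {_ ∷ xs} (here refl) qx ¬px with P? x | Q? x
  ... | yes px | _      = contradiction px ¬px
  ... | no _   | no ¬qx = contradiction qx ¬qx
  ... | no _   | yes _  = s≤s (length-filter-mono P⇒Q xs)
  length-filter-mono-< P⇒Q {xs = y ∷ _} (there x∈xs) qx ¬px with P? y | Q? y
  ... | yes _  | yes _  = s≤s (length-filter-mono-< P⇒Q x∈xs qx ¬px)
  ... | yes py | no ¬qy = contradiction (P⇒Q py) ¬qy
  ... | no _   | yes _  = ℕ.m≤n⇒m≤1+n (length-filter-mono-< P⇒Q x∈xs qx ¬px)
  ... | no _   | no _   = length-filter-mono-< P⇒Q x∈xs qx ¬px

  length-filter-cong-∈ : ∀ xs → (∀ {x} → x ∈ xs → (P x → Q x) × (Q x → P x)) →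
                         length (filter P? xs) ≡ length (filter Q? xs)
  length-filter-cong-∈ []       P⇔Q = refl
  length-filter-cong-∈ (x ∷ xs) P⇔Q with P? x | Q? x
  ... | yes _  | yes _  = cong suc (length-filter-cong-∈ xs (P⇔Q ∘ there))
  ... | yes px | no ¬qx = contradiction (proj₁ (P⇔Q (here refl)) px) ¬qx
  ... | no ¬px | yes qx = contradiction (proj₂ (P⇔Q (here refl)) qx) ¬px
  ... | no _   | no _   = length-filter-cong-∈ xs (P⇔Q ∘ there)

  length-filter-complementary : ∀ xs → (∀ {x} → x ∈ xs → (P x → ¬ Q x) × (¬ P x → Q x)) →
                                length (filter P? xs) + length (filter Q? xs) ≡ length xs
  length-filter-complementary []       _     = refl
  length-filter-complementary (x ∷ xs) P⇔¬Q with P? x | Q? x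
  ... | yes px | yes qx = contradiction qx (proj₁ (P⇔¬Q (here refl)) px)
  ... | yes _  | no _   = cong suc (length-filter-complementary xs (P⇔¬Q ∘ there))
  ... | no _   | yes _  = trans (ℕ.+-suc _ _) (cong suc (length-filter-complementary xs (P⇔¬Q ∘ there)))
  ... | no ¬px | no ¬qx = contradiction (proj₂ (P⇔¬Q (here refl)) ¬px) ¬qx

  length-filter-split : ∀ xs → length (filter P? xs) ≡
    length (filter P? (filter Q? xs)) + length (filter P? (filter (¬? ∘ Q?) xs))
  length-filter-split []       = refl
  length-filter-split (x ∷ xs) with Q? x
  length-filter-split (x ∷ xs) | yes _ with P? x
  ... | yes _ = cong suc (length-filter-split xs)
  ... | no _  = length-filter-split xs
  length-filter-split (x ∷ xs) | no _ with P? x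
  ... | yes _ = trans (cong suc (length-filter-split xs)) (sym (ℕ.+-suc _ _))
  ... | no _  = length-filter-split xs

-- Filtering the head `y` out of `xs` shortens `xs`, and the tail of the list without repetitions
-- still lies in what is left.
unique-⊆⇒length-≤ : DecidableEquality A → ∀ {xs ys : List A} →
                    Unique ys → ys ⊆ xs → length ys ≤ length xs
unique-⊆⇒length-≤ _≟_ {ys = []} _ _ = z≤n
unique-⊆⇒length-≤ _≟_ {xs} {y ∷ _} (y∉ys ∷ ys!) ys⊆xs = ℕ.≤-<-trans
  (unique-⊆⇒length-≤ _≟_ ys! λ z∈ys → ∈-filter⁺ y≢? (ys⊆xs (there z∈ys)) (All.lookup y∉ys z∈ys))
  (filter-notAll y≢? xs (Any.map (λ y≡z y≢z → y≢z y≡z) (ys⊆xs (here refl))))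
  where y≢? = λ z → ¬? (y ≟ z)

two-members⇒2≤length : DecidableEquality A → ∀ {xs : List A} {x y} →
                       x ≢ y → x ∈ xs → y ∈ xs → 2 ≤ length xs
two-members⇒2≤length _≟_ x≢y x∈ y∈ = unique-⊆⇒length-≤ _≟_ ((x≢y ∷ []) ∷ [] ∷ [])
  λ { (here refl) → x∈ ; (there (here refl)) → y∈ }

three-members⇒3≤length : DecidableEquality A → ∀ {xs : List A} {x y z} →
                         x ≢ y → x ≢ z → y ≢ z → x ∈ xs → y ∈ xs → z ∈ xs → 3 ≤ length xs
three-members⇒3≤length _≟_ x≢y x≢z y≢z x∈ y∈ z∈ =
  unique-⊆⇒length-≤ _≟_ ((x≢y ∷ x≢z ∷ []) ∷ (y≢z ∷ []) ∷ [] ∷ [])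
  λ { (here refl) → x∈ ; (there (here refl)) → y∈ ; (there (there (here refl))) → z∈ }

0<length⇒member : ∀ (xs : List A) → 0 < length xs → ∃[ x ] x ∈ xs
0<length⇒member (x ∷ _) _ = x , here refl

2≤length⇒two-members : ∀ {xs : List A} → Unique xs → 2 ≤ length xs →
                       ∃[ x ] ∃[ y ] (x ≢ y × x ∈ xs × y ∈ xs)
2≤length⇒two-members {xs = _ ∷ []}        _                 (s≤s ())
2≤length⇒two-members {xs = x ∷ y ∷ _} ((x≢y ∷ _) ∷ _) _ = x , y , x≢y , here refl , there (here refl)

-- Arithmetic of counts, parities and signs

k≤m∧m+n≤k+o⇒n≤o : ∀ {k m n o} → k ≤ m → m + n ≤ k + o → n ≤ o
k≤m∧m+n≤k+o⇒n≤o {k} {n = n} k≤m le = ℕ.+-cancelˡ-≤ k n _ (ℕ.≤-trans (ℕ.+-monoˡ-≤ n k≤m) le)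

2∤1 : 2 ∤ 1
2∤1 2∣1 with () ← ∣1⇒≡1 2∣1

even∧≤1⇒≤0 : ∀ {n} → 2 ∣ n → n ≤ 1 → n ≤ 0
even∧≤1⇒≤0 _   z≤n       = z≤n
even∧≤1⇒≤0 2∣1 (s≤s z≤n) = contradiction 2∣1 2∤1

odd∧≤1⇒≡1 : ∀ {n} → 2 ∤ n → n ≤ 1 → n ≡ 1
odd∧≤1⇒≡1 odd z≤n       = contradiction (2 ∣0) odd
odd∧≤1⇒≡1 _   (s≤s z≤n) = refl

opposite-*³ : ∀ x y z → (opposite x * y * z ≡ opposite (x * y * z)) ×
                        (x * opposite y * z ≡ opposite (x * y * z)) ×
                        (x * y * opposite z ≡ opposite (x * y * z))
opposite-*³ ⊕ ⊕ ⊕ = refl , refl , refl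
opposite-*³ ⊕ ⊕ ⊖ = refl , refl , refl
opposite-*³ ⊕ ⊖ ⊕ = refl , refl , refl
opposite-*³ ⊕ ⊖ ⊖ = refl , refl , refl
opposite-*³ ⊖ ⊕ ⊕ = refl , refl , refl
opposite-*³ ⊖ ⊕ ⊖ = refl , refl , refl
opposite-*³ ⊖ ⊖ ⊕ = refl , refl , refl
opposite-*³ ⊖ ⊖ ⊖ = refl , refl , refl

≢⇒≡opposite : ∀ {x y} → x ≢ y → y ≡ opposite x
≢⇒≡opposite { ⊕ } { ⊕ } x≢y = contradiction refl x≢y
≢⇒≡opposite { ⊕ } { ⊖ } x≢y = refl
≢⇒≡opposite { ⊖ } { ⊕ } x≢y = refl
≢⇒≡opposite { ⊖ } { ⊖ } x≢y = contradiction refl x≢y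

-- Triangles, their signs, and flips of an edge

module _ {G : Graph} where
  open Graph G

  _≟ᵗ_ : DecidableEquality (Triangle G)
  triangle i j k _ _ _ _ _ ≟ᵗ triangle i′ j′ k′ _ _ _ _ _ =
    map′ (λ { (refl , refl , refl) → refl }) (λ { refl → refl , refl , refl })
         (i Fin.≟ i′ ×-dec j Fin.≟ j′ ×-dec k Fin.≟ k′)

  -- Equal sides would identify two vertices that the increasing order keeps apart. The order proofs
  -- are irrelevant, hence `contradiction-irr`.
  side-injective : ∀ (T : Triangle G) {a b} → side T a ≡ side T b → a ≡ b
  side-injective T {zero}         {zero}         _    = refl
  side-injective T {suc zero}     {suc zero}     _    = refl
  side-injective T {suc (suc zero)} {suc (suc zero)} _ = refl
  side-injective (triangle i j k i<j j<k _ _ _) {zero} {suc zero} eq =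
    contradiction-irr i<j (Fin.<-irrefl (cong Edge.i eq))
  side-injective (triangle i j k i<j j<k _ _ _) {zero} {suc (suc zero)} eq =
    contradiction-irr j<k (Fin.<-irrefl (cong Edge.j eq))
  side-injective (triangle i j k i<j j<k _ _ _) {suc zero} {zero} eq =
    contradiction-irr i<j (Fin.<-irrefl (sym (cong Edge.i eq)))
  side-injective (triangle i j k i<j j<k _ _ _) {suc zero} {suc (suc zero)} eq =
    contradiction-irr i<j (Fin.<-irrefl (sym (cong Edge.i eq)))
  side-injective (triangle i j k i<j j<k _ _ _) {suc (suc zero)} {zero} eq =
    contradiction-irr j<k (Fin.<-irrefl (sym (cong Edge.j eq)))
  side-injective (triangle i j k i<j j<k _ _ _) {suc (suc zero)} {suc zero} eq =
    contradiction-irr i<j (Fin.<-irrefl (cong Edge.i eq))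

  triangleSign : State G → Triangle G → Sign
  triangleSign s T = s (side T zero) * s (side T (suc zero)) * s (side T (suc (suc zero)))

  triangleSign-cong : ∀ (s t : State G) T → (∀ a → s (side T a) ≡ t (side T a)) →
                      triangleSign s T ≡ triangleSign t T
  triangleSign-cong s t T s≡t =
    cong₂ _*_ (cong₂ _*_ (s≡t zero) (s≡t (suc zero))) (s≡t (suc (suc zero)))

  ¬Imbalanced⇒Balanced : ∀ {s : State G} {T} → ¬ Imbalanced s T → Balanced s T
  ¬Imbalanced⇒Balanced = decidable-stable (_ Sign.≟ ⊕)

  -- `FlipsAt e s` determines a state only pointwise; this is a chosen representative.
  flip : Edge G → State G → State G
  flip e s e′ with e′ ≟ᵉ e
  ... | yes _ = opposite (s e′)
  ... | no _  = s e′

  flip-flipsAt : ∀ e (s : State G) → FlipsAt e s (flip e s)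
  flip-flipsAt e s = at , away
    where
    at : flip e s e ≡ opposite (s e)
    at with e ≟ᵉ e
    ... | yes _  = refl
    ... | no e≢e = contradiction refl e≢e
    away : ∀ e′ → e′ ≢ e → flip e s e′ ≡ s e′
    away e′ e′≢e with e′ ≟ᵉ e
    ... | yes e′≡e = contradiction e′≡e e′≢e
    ... | no _     = refl

  flipsAt-sym : ∀ {e} {s t : State G} → FlipsAt e s t → FlipsAt e t s
  flipsAt-sym {e} {s} (at , away) =
    trans (sym (Sign.opposite-involutive (s e))) (cong opposite (sym at)) ,
    λ e′ e′≢e → sym (away e′ e′≢e)

  -- Both labels at `e` are negated and all others are kept, so agreement is neither created nor
  -- destroyed anywhere.
  flip-preserves-agreement : ∀ e (s t : State G) e′ → flip e s e′ ≡ flip e t e′ ⇔ s e′ ≡ t e′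
  flip-preserves-agreement e s t e′ with e′ ≟ᵉ e
  ... | yes _ = mk⇔ Sign.opposite-injective (cong opposite)
  ... | no _  = mk⇔ (λ eq → eq) (λ eq → eq)

  module _ {e} {s t : State G} (f : FlipsAt e s t) where

    triangleSign-∉ : ∀ {T} → ¬ e ∈ᵗ T → triangleSign t T ≡ triangleSign s T
    triangleSign-∉ {T} e∉T = triangleSign-cong t s T λ a → proj₂ f _ λ eq → e∉T (a , eq)

    -- By `side-injective`, exactly one of the three factors is negated.
    triangleSign-∈ : ∀ {T} → e ∈ᵗ T → triangleSign t T ≡ opposite (triangleSign s T)
    triangleSign-∈ {T} (a , refl) = go a (proj₁ f) λ b b≢a → proj₂ f _ λ eq → b≢a (side-injective T eq)
      where
      go : ∀ a → t (side T a) ≡ opposite (s (side T a)) →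
           (∀ b → b ≢ a → t (side T b) ≡ s (side T b)) → triangleSign t T ≡ opposite (triangleSign s T)
      go zero at away rewrite at | away (suc zero) (λ ()) | away (suc (suc zero)) (λ ()) =
        proj₁ (opposite-*³ (s (side T zero)) _ _)
      go (suc zero) at away rewrite at | away zero (λ ()) | away (suc (suc zero)) (λ ()) =
        proj₁ (proj₂ (opposite-*³ (s (side T zero)) (s (side T (suc zero))) _))
      go (suc (suc zero)) at away rewrite at | away zero (λ ()) | away (suc zero) (λ ()) =
        proj₂ (proj₂ (opposite-*³ (s (side T zero)) (s (side T (suc zero))) (s (side T (suc (suc zero))))))

    balanced-∉ : ∀ {T} → ¬ e ∈ᵗ T → Balanced s T → Balanced t T
    balanced-∉ {T} e∉T bal = trans (triangleSign-∉ {T} e∉T) bal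

    balanced⇒imbalanced : ∀ {T} → e ∈ᵗ T → Balanced s T → Imbalanced t T
    balanced⇒imbalanced {T} e∈T bal balₜ =
      Sign.s≢opposite[s] (triangleSign s T) (trans bal (trans (sym balₜ) (triangleSign-∈ {T} e∈T)))

    imbalanced⇒balanced : ∀ {T} → e ∈ᵗ T → Imbalanced s T → Balanced t T
    imbalanced⇒balanced {T} e∈T imb = trans (triangleSign-∈ {T} e∈T) (sym (≢⇒≡opposite imb))

  -- Counting imbalanced triangles and triangles at an edge

  balanced-resp-≗ : ∀ {s t : State G} → s ≗ t → ∀ T → Balanced s T → Balanced t T
  balanced-resp-≗ {s} {t} s≗t T bal = trans (sym (triangleSign-cong s t T λ a → s≗t (side T a))) bal

  #imbalanced-resp-≗ : ∀ (s t : State G) → s ≗ t → #imbalanced s ≡ #imbalanced t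
  #imbalanced-resp-≗ s t s≗t = length-filter-cong-∈ (imbalanced? s) (imbalanced? t) (triangles G)
    λ {T} _ → (λ imb bal → imb (balanced-resp-≗ {t} {s} (sym ∘ s≗t) T bal)) ,
              (λ imb bal → imb (balanced-resp-≗ {s} {t} s≗t T bal))

  #imbalanced≤0⇒balanced : ∀ (s : State G) → #imbalanced s ≤ 0 → CompletelyBalanced s
  #imbalanced≤0⇒balanced s le T = ¬Imbalanced⇒Balanced {s} {T} λ imb → ℕ.<-irrefl refl
    (ℕ.<-≤-trans (filter-some (imbalanced? s) (lose (∈-triangles G T) imb)) le)

  imbalancedTriangle : ∀ (s : State G) → 0 < #imbalanced s → ∃[ T ] Imbalanced s T
  imbalancedTriangle s 0<c with 0<length⇒member (filter (imbalanced? s) (triangles G)) 0<c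
  ... | T , T∈ = T , proj₂ (∈-filter⁻ (imbalanced? s) {xs = triangles G} T∈)

  twoImbalancedTriangles : ∀ (s : State G) → 1 < #imbalanced s →
                           ∃[ T ] ∃[ T′ ] (T ≢ T′ × Imbalanced s T × Imbalanced s T′)
  twoImbalancedTriangles s 1<c
    with 2≤length⇒two-members {xs = filter (imbalanced? s) (triangles G)}
           (Unique.filter⁺ (imbalanced? s) (triangles-unique G)) 1<c
  ... | T , T′ , T≢T′ , T∈ , T′∈ =
    T , T′ , T≢T′ , proj₂ (∈-filter⁻ (imbalanced? s) {xs = triangles G} T∈) ,
                    proj₂ (∈-filter⁻ (imbalanced? s) {xs = triangles G} T′∈)

  imbalanced-unique : ∀ {s : State G} → #imbalanced s ≤ 1 → ∀ {T T′} →
                      Imbalanced s T → Imbalanced s T′ → T ≡ T′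
  imbalanced-unique {s} c≤1 {T} {T′} imb imb′ = decidable-stable (T ≟ᵗ T′) λ T≢T′ →
    ℕ.<-irrefl refl (ℕ.<-≤-trans (two-members⇒2≤length _≟ᵗ_ T≢T′
      (∈-filter⁺ (imbalanced? s) (∈-triangles G T) imb)
      (∈-filter⁺ (imbalanced? s) (∈-triangles G T′) imb′)) c≤1)

  -- The list whose length is `#trianglesAt e` by definition.
  trianglesAt : Edge G → List (Triangle G)
  trianglesAt e = filter (e ∈ᵗ?_) (triangles G)

  ∈-trianglesAt : ∀ {e T} → e ∈ᵗ T → T ∈ trianglesAt e
  ∈-trianglesAt {e} {T} e∈T = ∈-filter⁺ (e ∈ᵗ?_) (∈-triangles G T) e∈T

  triangleAt : ∀ e → 0 < #trianglesAt e → ∃[ T ] e ∈ᵗ T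
  triangleAt e 0<n with 0<length⇒member (trianglesAt e) 0<n
  ... | T , T∈ = T , proj₂ (∈-filter⁻ (e ∈ᵗ?_) {xs = triangles G} T∈)

  third-∉ : ∀ {e} → #trianglesAt e ≤ 2 → ∀ {T T′ T″} → T ≢ T′ → T ≢ T″ → T′ ≢ T″ →
            e ∈ᵗ T → e ∈ᵗ T′ → ¬ e ∈ᵗ T″
  third-∉ n≤2 T≢T′ T≢T″ T′≢T″ e∈T e∈T′ e∈T″ = ℕ.<-irrefl refl (ℕ.<-≤-trans
    (three-members⇒3≤length _≟ᵗ_ T≢T′ T≢T″ T′≢T″ (∈-trianglesAt e∈T) (∈-trianglesAt e∈T′)
      (∈-trianglesAt e∈T″)) n≤2)

  -- Effect of a flip on the number of imbalances

  #imbalancedAt #imbalancedOff : Edge G → State G → ℕ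
  #imbalancedAt  e s = length (filter (imbalanced? s) (trianglesAt e))
  #imbalancedOff e s = length (filter (imbalanced? s) (filter (¬? ∘ (e ∈ᵗ?_)) (triangles G)))

  0<#imbalancedAt : ∀ {e} (s : State G) {T} → e ∈ᵗ T → Imbalanced s T → 0 < #imbalancedAt e s
  0<#imbalancedAt s e∈T imb = filter-some (imbalanced? s) (lose (∈-trianglesAt e∈T) imb)

  #imbalanced-split : ∀ e (s : State G) → #imbalanced s ≡ #imbalancedAt e s + #imbalancedOff e s
  #imbalanced-split e s = length-filter-split (imbalanced? s) (e ∈ᵗ?_) (triangles G)

  module _ {e} {s t : State G} (f : FlipsAt e s t) where

    #imbalancedOff-flip : #imbalancedOff e t ≡ #imbalancedOff e s
    #imbalancedOff-flip = length-filter-cong-∈ (imbalanced? t) (imbalanced? s) _ λ {T} T∈ →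
      let e∉T = proj₂ (∈-filter⁻ (¬? ∘ (e ∈ᵗ?_)) {xs = triangles G} T∈) in
      (λ imb bal → imb (balanced-∉ f {T} e∉T bal)) ,
      (λ imb bal → imb (balanced-∉ (flipsAt-sym f) {T} e∉T bal))

    -- The flip exchanges balanced and imbalanced among the triangles containing `e`, so each of
    -- them is imbalanced in exactly one of `s` and `t`.
    #imbalancedAt-flip : #imbalancedAt e s + #imbalancedAt e t ≡ #trianglesAt e
    #imbalancedAt-flip = length-filter-complementary (imbalanced? s) (imbalanced? t) (trianglesAt e)
      λ {T} T∈ → let e∈T = proj₂ (∈-filter⁻ (e ∈ᵗ?_) {xs = triangles G} T∈) in
      (λ imb imb′ → imb′ (imbalanced⇒balanced f {T} e∈T imb)) ,
      (λ ¬imb → balanced⇒imbalanced f {T} e∈T (¬Imbalanced⇒Balanced {s} {T} ¬imb))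

    -- The two triangles at `e` contribute 2 to the sum, and the imbalances away from `e` are
    -- counted twice.
    #imbalanced-flip-parity : #trianglesAt e ≡ 2 → 2 ∣ #imbalanced s + #imbalanced t
    #imbalanced-flip-parity n≡2 = subst (2 ∣_) (sym sum)
      -- `m∣m*n off` is about `2 * off`, which computes to `off + (off + 0)`.
      (∣m∣n⇒∣m+n (∣-refl {2}) (subst (2 ∣_) (cong (off +_) (ℕ.+-identityʳ off)) (m∣m*n off)))
      where
      off = #imbalancedOff e s
      rearrange : ∀ x y z → (x + z) + (y + z) ≡ (x + y) + (z + z)
      rearrange = solve-∀
      sum : #imbalanced s + #imbalanced t ≡ 2 + (off + off)
      sum = begin
        #imbalanced s + #imbalanced t
          ≡⟨ cong₂ _+_ (#imbalanced-split e s) (#imbalanced-split e t) ⟩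
        (#imbalancedAt e s + off) + (#imbalancedAt e t + #imbalancedOff e t)
          ≡⟨ cong (λ n → (#imbalancedAt e s + off) + (#imbalancedAt e t + n)) #imbalancedOff-flip ⟩
        (#imbalancedAt e s + off) + (#imbalancedAt e t + off)
          ≡⟨ rearrange (#imbalancedAt e s) (#imbalancedAt e t) off ⟩
        (#imbalancedAt e s + #imbalancedAt e t) + (off + off)
          ≡⟨ cong (_+ (off + off)) (trans #imbalancedAt-flip n≡2) ⟩
        2 + (off + off) ∎
        where open ≡-Reasoning

    #imbalanced-flip-< : #imbalancedAt e t < #imbalancedAt e s → #imbalanced t < #imbalanced s
    #imbalanced-flip-< lt =
      subst₂ _<_ (sym (#imbalanced-split e t)) (sym (#imbalanced-split e s))
        (ℕ.+-mono-<-≤ lt (ℕ.≤-reflexive #imbalancedOff-flip))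

    -- Of at most two triangles at `e` at least one is imbalanced before the flip, so at most one is
    -- afterwards.
    #imbalanced-flip-≤ : #trianglesAt e ≤ 2 → ∀ {T} → e ∈ᵗ T → Imbalanced s T →
                         #imbalanced t ≤ #imbalanced s
    #imbalanced-flip-≤ n≤2 e∈T imb =
      subst₂ _≤_ (sym (#imbalanced-split e t)) (sym (#imbalanced-split e s))
        (ℕ.+-mono-≤ (ℕ.≤-trans (k≤m∧m+n≤k+o⇒n≤o 0<at at≤2) 0<at) (ℕ.≤-reflexive #imbalancedOff-flip))
      where
      0<at = 0<#imbalancedAt s e∈T imb
      at≤2 = ℕ.≤-trans (ℕ.≤-reflexive #imbalancedAt-flip) n≤2

    -- The only triangle at `e` becomes balanced, and there is no other one to take over the
    -- imbalance.
    #imbalanced-flip-boundary : #trianglesAt e ≡ 1 → ∀ {T} → e ∈ᵗ T → Imbalanced s T →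
                                #imbalanced t < #imbalanced s
    #imbalanced-flip-boundary n≡1 e∈T imb =
      #imbalanced-flip-< (ℕ.≤-<-trans (k≤m∧m+n≤k+o⇒n≤o 0<at at≤1) 0<at)
      where
      0<at = 0<#imbalancedAt s e∈T imb
      at≤1 = ℕ.≤-reflexive (trans #imbalancedAt-flip n≡1)

    -- `T` and `T′` are all the triangles at `e`, and both become balanced.
    #imbalanced-flip-annihilate : #trianglesAt e ≤ 2 → ∀ {T T′} → T ≢ T′ → e ∈ᵗ T → e ∈ᵗ T′ →
                                  Imbalanced s T → Imbalanced s T′ → #imbalanced t < #imbalanced s
    #imbalanced-flip-annihilate n≤2 T≢T′ e∈T e∈T′ imb imb′ =
      #imbalanced-flip-< (ℕ.≤-<-trans (k≤m∧m+n≤k+o⇒n≤o 2≤at at≤2) (0<#imbalancedAt s e∈T imb))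
      where
      2≤at = two-members⇒2≤length _≟ᵗ_ T≢T′
        (∈-filter⁺ (imbalanced? s) (∈-trianglesAt e∈T) imb)
        (∈-filter⁺ (imbalanced? s) (∈-trianglesAt e∈T′) imb′)
      at≤2 = ℕ.≤-trans (ℕ.≤-reflexive #imbalancedAt-flip) n≤2

  -- Moving an imbalance along a walk in the triadic dual

  Adjacent : Rel (Triangle G) _
  Adjacent T T′ = ∃[ e ] (e ∈ᵗ T × e ∈ᵗ T′)

  flipMove : ∀ {e T} (s : State G) → e ∈ᵗ T → Imbalanced s T → Move s (flip e s)
  flipMove {e} {T} s e∈T imb = T , e , imb , e∈T , flip-flipsAt e s

  move-resp-≗ˡ : ∀ {s s′ t : State G} → s ≗ s′ → Move s t → Move s′ t
  move-resp-≗ˡ {s} {s′} s≗s′ (T , e , imb , e∈T , at , away) =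
    T , e , (imb ∘ balanced-resp-≗ {s′} {s} (sym ∘ s≗s′) T) , e∈T ,
    trans at (cong opposite (s≗s′ e)) , λ e′ e′≢e → trans (away e′ e′≢e) (s≗s′ e′)

  move-resp-≗ʳ : ∀ {s t t′ : State G} → t ≗ t′ → Move s t → Move s t′
  move-resp-≗ʳ t≗t′ (T , e , imb , e∈T , at , away) =
    T , e , imb , e∈T , trans (sym (t≗t′ e)) at , λ e′ e′≢e → trans (sym (t≗t′ e′)) (away e′ e′≢e)

  reachable-resp-≗ˡ : ∀ {s s′ t : State G} → s ≗ s′ → Reachable s t → Reachable s′ t
  -- An empty path has to end at `s′` itself, so the change of representative goes into the final
  -- pointwise equality.
  reachable-resp-≗ˡ {s′ = s′} s≗s′ (u , ε , u≗t)       = s′ , ε , λ e → trans (sym (s≗s′ e)) (u≗t e)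
  reachable-resp-≗ˡ           s≗s′ (u , m ◅ ms , u≗t) = u , move-resp-≗ˡ s≗s′ m ◅ ms , u≗t

  star-reachable : ∀ {s t u : State G} → Star Move s t → Reachable t u → Reachable s u
  star-reachable p (v , q , v≗u) = v , p ◅◅ q , v≗u

  reachable-star : ∀ {s t u : State G} → Reachable s t → Star Move t u → Reachable s u
  reachable-star (v , p , v≗t) q =
    star-reachable p (reachable-resp-≗ˡ (sym ∘ v≗t) (_ , q , λ _ → refl))

  -- The outcome of a walk on which the imbalance meets no other. By `source`, a walk from `T` to a
  -- different triangle that is imbalanced in `s` cannot end this way; this forces an annihilation
  -- when two imbalances are present.
  record Transported (s : State G) (T X : Triangle G) : Set where
    field
      target      : State G
      moves       : Star Move s target
      #target≤    : #imbalanced target ≤ #imbalanced s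
      imbalancedX : Imbalanced target X
      source      : T ≡ X ⊎ Balanced s X

  -- In the first alternative the imbalance met another one on its way, and both were annihilated.
  transport : (∀ e → #trianglesAt e ≤ 2) → ∀ {T X} → Star Adjacent T X → ∀ s → Imbalanced s T →
              (∃[ t ] (Star Move s t × #imbalanced t < #imbalanced s)) ⊎ Transported s T X
  transport n≤2 ε s imb = inj₂ record
    { target = s ; moves = ε ; #target≤ = ℕ.≤-refl ; imbalancedX = imb ; source = inj₁ refl }
  transport n≤2 {T} {X} (_◅_ {j = T′} (e , e∈T , e∈T′) path) s imb with T ≟ᵗ T′
  -- A step of the walk may stay at the same triangle, since adjacency only asks for a common side.
  ... | yes refl = transport n≤2 path s imb
  ... | no T≢T′ with imbalanced? s T′
  ...   | yes imb′ = inj₁ (flip e s , flipMove s e∈T imb ◅ ε ,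
            #imbalanced-flip-annihilate (flip-flipsAt e s) (n≤2 e) T≢T′ e∈T e∈T′ imb imb′)
  ...   | no ¬imb′
    with transport n≤2 path (flip e s)
           (balanced⇒imbalanced (flip-flipsAt e s) {T′} e∈T′ (¬Imbalanced⇒Balanced {s} {T′} ¬imb′))
  ...     | inj₁ (t , ms , lt) = inj₁ (t , flipMove s e∈T imb ◅ ms ,
              ℕ.<-≤-trans lt (#imbalanced-flip-≤ (flip-flipsAt e s) (n≤2 e) e∈T imb))
  ...     | inj₂ tr = inj₂ record
            { target      = target
            ; moves       = flipMove s e∈T imb ◅ moves
            ; #target≤    = ℕ.≤-trans #target≤ (#imbalanced-flip-≤ (flip-flipsAt e s) (n≤2 e) e∈T imb)
            ; imbalancedX = imbalancedX
            ; source      = pullBack source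
            }
    where
    open Transported tr
    pullBack : T′ ≡ X ⊎ Balanced (flip e s) X → T ≡ X ⊎ Balanced s X
    pullBack (inj₁ refl) = inj₂ (¬Imbalanced⇒Balanced {s} {T′} ¬imb′)
    pullBack (inj₂ balX) with T ≟ᵗ X | T′ ≟ᵗ X
    ... | yes T≡X | _        = inj₁ T≡X
    ... | no _    | yes refl = inj₂ (¬Imbalanced⇒Balanced {s} {T′} ¬imb′)
    -- `T` and `T′` already account for the two triangles allowed at `e`, so the flip leaves `X`
    -- untouched.
    ... | no T≢X  | no T′≢X  = inj₂ (balanced-∉ (flipsAt-sym (flip-flipsAt e s)) {X}
                                 (third-∉ (n≤2 e) T≢T′ T≢X T′≢X e∈T e∈T′) balX)

  -- Iterated improvement

  descend : ∀ k → (∀ (s : State G) → k < #imbalanced s →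
                   ∃[ t ] (Star Move s t × #imbalanced t < #imbalanced s)) →
            ∀ s → ∃[ t ] (Star Move s t × #imbalanced t ≤ k)
  descend k improve s = go s (<-wellFounded (#imbalanced s))
    where
    go : ∀ s → Acc _<_ (#imbalanced s) → ∃[ t ] (Star Move s t × #imbalanced t ≤ k)
    go s (acc rec) with k ℕ.<? #imbalanced s
    ... | no k≮  = s , ε , ℕ.≮⇒≥ k≮
    ... | yes k< with improve s k<
    ...   | t , ms , lt with go t (rec lt)
    ...     | u , ms′ , u≤k = u , ms ◅◅ ms′ , u≤k

  -- Infinite paths

  -- Any successor will do: the choice only serves to produce an infinite path from every state,
  -- because recurrence quantifies over such paths.
  step : ∀ (s : State G) → ∃[ t ] Step s t
  step s with #imbalanced s ℕ.≤? 0
  ... | yes c≤0 = s , inj₂ (#imbalanced≤0⇒balanced s c≤0 , λ _ → refl)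
  ... | no  c≰0 with imbalancedTriangle s (ℕ.≰⇒> c≰0)
  ...   | T , imb = flip (side T zero) s , inj₁ (flipMove {T = T} s (zero , refl) imb)

  run : State G → ℕ → State G
  run s zero    = s
  run s (suc n) = proj₁ (step (run s n))

  run-infinitePath : ∀ s → InfinitePath s (run s)
  run-infinitePath s = (λ _ → refl) , λ n → proj₂ (step (run s n))

  prefix : ∀ {s t : State G} → Star Move s t → (ℕ → State G) → ℕ → State G
  prefix         ε        π n       = π n
  prefix {s = s} (_ ◅ _)  π zero    = s
  prefix         (_ ◅ ms) π (suc n) = prefix ms π n

  prefix-infinitePath : ∀ {s t π} (ms : Star Move s t) → InfinitePath t π →
                        InfinitePath s (prefix ms π)
  prefix-infinitePath ε                 path = path
  prefix-infinitePath {π = π} (_◅_ {s} m ms) path = (λ _ → refl) , steps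
    where
    rest = prefix-infinitePath ms path
    steps : ∀ n → Step (prefix (m ◅ ms) π n) (prefix ms π n)
    -- The rest of the path starts at a state that is only pointwise equal to the target of `m`.
    steps zero    = inj₁ (move-resp-≗ʳ (sym ∘ proj₁ rest) m)
    steps (suc n) = proj₂ rest n

  starLength : ∀ {s t : State G} → Star Move s t → ℕ
  starLength ε        = 0
  starLength (_ ◅ ms) = suc (starLength ms)

  prefix-+ : ∀ {s t π} (ms : Star Move s t) n → prefix ms π (starLength ms + n) ≡ π n
  prefix-+ ε        n = refl
  prefix-+ (_ ◅ ms) n = prefix-+ ms n

  -- Recurrence in terms of finite paths: follow `p` to `x`, then `q` to `u`, then any run. This
  -- infinite path is at `x` at time `starLength p` and at `u` after `starLength q` further steps.
  -- The state `x` stands in for `s`, which is reached only up to pointwise equality.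
  recurrent⇒returns : ∀ {s₀ s : State G} → Recurrent s₀ s →
                      ∃[ x ] (Star Move s₀ x × x ≗ s × (∀ {u} → Star Move x u → Reachable u s))
  recurrent⇒returns {s₀} {s} ((x , p , x≗s) , returns) = x , p , x≗s , λ {u} q →
    let π = prefix p (prefix q (run u)) in
    subst (λ v → Reachable v s)
      (trans (prefix-+ p _) (prefix-+ q 0))
      (returns π (prefix-infinitePath p (prefix-infinitePath q (run-infinitePath u)))
        -- The added zeros put both times into the form that `prefix-+` handles.
        (starLength p + 0) (starLength p + (starLength q + 0)) (ℕ.+-monoʳ-≤ (starLength p) z≤n)
        λ e → trans (cong-app (trans (prefix-+ p 0) (prefix-start q)) e) (x≗s e))
    where
    prefix-start : ∀ {x u} (q : Star Move x u) → prefix q (run u) 0 ≡ x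
    prefix-start ε       = refl
    prefix-start (_ ◅ _) = refl

  -- Recurrence of completely balanced states

  completelyBalanced-stuck : ∀ {s t : State G} → CompletelyBalanced s → Reachable s t → s ≗ t
  completelyBalanced-stuck bal (_ , ε , s≗t)                    = s≗t
  completelyBalanced-stuck bal (_ , (T , _ , imb , _) ◅ _ , _) = contradiction (bal T) imb

  completelyBalanced-resp-≗ : ∀ {s t : State G} → s ≗ t → CompletelyBalanced s → CompletelyBalanced t
  completelyBalanced-resp-≗ {s} {t} s≗t bal T = balanced-resp-≗ {s} {t} s≗t T (bal T)

  completelyBalanced⇒returns : ∀ {s₀ s : State G} {π} → InfinitePath s₀ π → CompletelyBalanced s →
                               ∀ {m n} → m ≤ n → π m ≗ s → π n ≗ s
  completelyBalanced⇒returns {s = s} {π} (_ , steps) bal m≤n πm≗s = go (ℕ.≤⇒≤′ m≤n)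
    where
    go : ∀ {n} → _ ≤′ n → π n ≗ s
    go (≤′-reflexive refl) = πm≗s
    go (≤′-step {n} m≤n) with steps n
    ... | inj₁ (T , _ , imb , _) = contradiction (completelyBalanced-resp-≗ (sym ∘ go m≤n) bal T) imb
    ... | inj₂ (_ , πn≗πn+1)     = λ e → trans (sym (πn≗πn+1 e)) (go m≤n e)

  -- If `s` is recurrent, a completely balanced `b` can be reached after visiting `s`; as no move
  -- leaves `b`, the return to `s` forces `b` and `s` to agree. Conversely, a path that has reached
  -- a completely balanced state stays there.
  recurrent⇔completelyBalanced :
    ∀ {s₀} → (∀ {x} → Star Move s₀ x → ∃[ b ] (Star Move x b × #imbalanced b ≤ 0)) →
    ∀ s → Recurrent s₀ s ⇔ (CompletelyBalanced s × Reachable s₀ s)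
  recurrent⇔completelyBalanced {s₀} balance s = mk⇔ to from
    where
    to : Recurrent s₀ s → CompletelyBalanced s × Reachable s₀ s
    to rec with recurrent⇒returns rec
    ... | x , p , _ , returns with balance p
    ...   | b , q , b≤0 = completelyBalanced-resp-≗ (completelyBalanced-stuck b-bal (returns q)) b-bal , proj₁ rec
      where
      b-bal : CompletelyBalanced b
      b-bal = #imbalanced≤0⇒balanced b b≤0
    from : CompletelyBalanced s × Reachable s₀ s → Recurrent s₀ s
    from (bal , reach) = reach , λ π path m n m≤n πm≗s →
      π n , ε , completelyBalanced⇒returns path bal m≤n πm≗s

-- Lowering the number of imbalances

module _ (G : Graph) (connected : Connected (T₃ G)) (n≤2 : ∀ (e : Edge G) → #trianglesAt e ≤ 2) where

  -- An imbalance is carried to the triangle at the boundary edge, unless it is annihilated on the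
  -- way, and flipping that edge removes it.
  boundary⇒improve : ∃[ e ] #trianglesAt {G} e ≡ 1 → ∀ s → 0 < #imbalanced s →
                     ∃[ t ] (Star Move s t × #imbalanced t < #imbalanced s)
  boundary⇒improve (e , n≡1) s 0<c
    with imbalancedTriangle s 0<c | triangleAt e (ℕ.≤-reflexive (sym n≡1))
  ... | T , imb | X , e∈X with transport n≤2 (connected T X) s imb
  ...   | inj₁ improved = improved
  ...   | inj₂ tr = flip e target , moves ◅◅ flipMove target e∈X imbalancedX ◅ ε ,
            ℕ.<-≤-trans (#imbalanced-flip-boundary (flip-flipsAt e target) n≡1 e∈X imbalancedX) #target≤
    where open Transported tr

  -- One imbalance is sent towards another; `source` rules out that it arrives without an
  -- annihilation.
  pair⇒improve : ∀ s → 1 < #imbalanced s → ∃[ t ] (Star Move s t × #imbalanced t < #imbalanced s)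
  pair⇒improve s 1<c with twoImbalancedTriangles s 1<c
  ... | T , X , T≢X , imb , imb′ with transport n≤2 (connected T X) s imb
  ...   | inj₁ improved = improved
  ...   | inj₂ tr with Transported.source tr
  ...     | inj₁ T≡X  = contradiction T≡X T≢X
  ...     | inj₂ balX = contradiction balX imb′

-- Parity and single imbalances when every edge lies in two triangles

module _ {G : Graph} (n≡2 : ∀ (e : Edge G) → #trianglesAt e ≡ 2) where

  private
    n≤2 : ∀ e → #trianglesAt e ≤ 2
    n≤2 = ℕ.≤-reflexive ∘ n≡2

  move-parity : ∀ {s t : State G} → Move s t → 2 ∣ #imbalanced s + #imbalanced t
  move-parity (_ , e , _ , _ , f) = #imbalanced-flip-parity f (n≡2 e)

  move-even : ∀ {s t : State G} → Move s t → 2 ∣ #imbalanced s → 2 ∣ #imbalanced t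
  move-even m even = ∣m+n∣m⇒∣n (move-parity m) even

  move-odd : ∀ {s t : State G} → Move s t → 2 ∤ #imbalanced s → 2 ∤ #imbalanced t
  move-odd {s} {t} m odd even =
    odd (∣m+n∣m⇒∣n (subst (2 ∣_) (ℕ.+-comm (#imbalanced s) _) (move-parity m)) even)

  star-even : ∀ {s t : State G} → Star Move s t → 2 ∣ #imbalanced s → 2 ∣ #imbalanced t
  star-even ε        even = even
  star-even (m ◅ ms) even = star-even ms (move-even m even)

  star-odd : ∀ {s t : State G} → Star Move s t → 2 ∤ #imbalanced s → 2 ∤ #imbalanced t
  star-odd ε        odd = odd
  star-odd (m ◅ ms) odd = star-odd ms (move-odd m odd)

  -- The count stays odd and cannot grow.
  move-single : ∀ {s t : State G} → Move s t → #imbalanced s ≡ 1 → #imbalanced t ≡ 1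
  move-single {s} m@(_ , e , imb , e∈T , f) s≡1 =
    odd∧≤1⇒≡1 (move-odd {s} m (subst (2 ∤_) (sym s≡1) 2∤1))
              (ℕ.≤-trans (#imbalanced-flip-≤ f (n≤2 e) e∈T imb) (ℕ.≤-reflexive s≡1))

  star-single : ∀ {s t : State G} → Star Move s t → #imbalanced s ≡ 1 → #imbalanced t ≡ 1
  star-single ε        s≡1 = s≡1
  star-single (m ◅ ms) s≡1 = star-single ms (move-single m s≡1)

  reachable-single : ∀ {s t : State G} → Reachable s t → #imbalanced s ≡ 1 → #imbalanced t ≡ 1
  reachable-single {t = t} (u , ms , u≗t) s≡1 =
    trans (sym (#imbalanced-resp-≗ u t u≗t)) (star-single ms s≡1)

  infinitePath-odd : ∀ {s₀ : State G} {π} → InfinitePath s₀ π → 2 ∤ #imbalanced s₀ →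
                     ∀ n → 2 ∤ #imbalanced (π n)
  infinitePath-odd {s₀} {π} (start , _) odd zero =
    subst (2 ∤_) (#imbalanced-resp-≗ s₀ (π 0) (sym ∘ start)) odd
  infinitePath-odd {s₀} {π} path@(_ , steps) odd (suc n) with steps n
  ... | inj₁ m       = move-odd m (infinitePath-odd path odd n)
  ... | inj₂ (_ , eq) = subst (2 ∤_) (#imbalanced-resp-≗ (π n) (π (suc n)) eq) (infinitePath-odd path odd n)

  -- `u′` and `s′` are meant to arise from `u` and `s` by the same flips, so that they disagree at
  -- the same edges. The moves from `s` are stored reversed: a path from `u′` to `s′` then yields
  -- one from `u` to `s`.
  record Conjugated (u s : State G) (X : Triangle G) : Set where
    field
      u′ s′       : State G
      forth       : Star Move u u′
      back        : Star Move s′ s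
      u′≡1        : #imbalanced u′ ≡ 1
      s′≡1        : #imbalanced s′ ≡ 1
      imbalanced-u′ : Imbalanced u′ X
      agreement   : ∀ e → u′ e ≡ s′ e ⇔ u e ≡ s e

  conjugate : ∀ {T X} → Star Adjacent T X → ∀ u s → #imbalanced u ≡ 1 → #imbalanced s ≡ 1 →
              Imbalanced u T → Imbalanced s T → Conjugated u s X
  conjugate ε u s u≡1 s≡1 imbU imbS = record
    { u′ = u ; s′ = s ; forth = ε ; back = ε ; u′≡1 = u≡1 ; s′≡1 = s≡1
    ; imbalanced-u′ = imbU ; agreement = λ e → mk⇔ (λ eq → eq) (λ eq → eq) }
  conjugate {T} (_◅_ {j = T′} (e , e∈T , e∈T′) path) u s u≡1 s≡1 imbU imbS with T ≟ᵗ T′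
  ... | yes refl = conjugate path u s u≡1 s≡1 imbU imbS
  ... | no T≢T′ = record
    { u′ = u′ ; s′ = s′
    ; forth = flipMove u e∈T imbU ◅ forth
    -- After the flip of `e` the triangle `T′` is imbalanced and contains `e`, so flipping `e` back
    -- is a legal move.
    ; back  = back ◅◅ (T′ , e , across s s≡1 imbS , e∈T′ , flipsAt-sym (flip-flipsAt e s)) ◅ ε
    ; u′≡1 = u′≡1 ; s′≡1 = s′≡1 ; imbalanced-u′ = imbalanced-u′
    ; agreement = λ e′ → flip-preserves-agreement e u s e′ ⇔-∘ agreement e′
    }
    where
    across : ∀ v → #imbalanced v ≡ 1 → Imbalanced v T → Imbalanced (flip e v) T′
    across v v≡1 imb = balanced⇒imbalanced (flip-flipsAt e v) {T′} e∈T′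
      (¬Imbalanced⇒Balanced {s = v} {T = T′}
        λ imb′ → T≢T′ (imbalanced-unique {s = v} (ℕ.≤-reflexive v≡1) imb imb′))
    open Conjugated (conjugate path (flip e u) (flip e s)
      (move-single (flipMove u e∈T imbU) u≡1) (move-single (flipMove s e∈T imbS) s≡1)
      (across u u≡1 imbU) (across s s≡1 imbS))

  -- Reaching one state with a single imbalance from another

  edges : List (Edge G)
  edges = cartesianProductWith side (triangles G) (allFin 3)

  ∈-edges : ∀ e → e ∈ edges
  ∈-edges e with triangleAt e (subst (0 <_) (sym (n≡2 e)) z<s)
  ... | T , a , refl = ∈-cartesianProductWith⁺ side (∈-triangles G T) (∈-allFin a)

  differ? : ∀ (u s : State G) → Decidable (λ e → u e ≢ s e)
  differ? u s e = ¬? (u e Sign.≟ s e)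

  -- The measure for termination. An edge occurs in `edges` once for each triangle containing it;
  -- such repetitions do no harm, as only strict decrease matters.
  #differing : State G → State G → ℕ
  #differing u s = length (filter (differ? u s) edges)

  -- There are only two signs, so flipping a label of `u` that differs from that of `s` makes them
  -- agree.
  #differing-flip : ∀ {e} {u s : State G} → u e ≢ s e → #differing (flip e u) s < #differing u s
  #differing-flip {e} {u} {s} ue≢se =
    length-filter-mono-< (differ? (flip e u) s) (differ? u s) keep (∈-edges e) ue≢se (λ ≢ → ≢ at)
    where
    at : flip e u e ≡ s e
    at = trans (proj₁ (flip-flipsAt e u)) (sym (≢⇒≡opposite ue≢se))
    keep : ∀ {e′} → flip e u e′ ≢ s e′ → u e′ ≢ s e′
    keep {e′} ≢ with e′ ≟ᵉ e
    ... | yes refl = ue≢se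
    ... | no _     = ≢

  single-reachable : Connected (T₃ G) → ∀ (u s : State G) → #imbalanced u ≡ 1 → #imbalanced s ≡ 1 →
                     Reachable u s
  single-reachable connected u s u≡1 s≡1 = go u s u≡1 s≡1 (<-wellFounded _)
    where
    go : ∀ u s → #imbalanced u ≡ 1 → #imbalanced s ≡ 1 → Acc _<_ (#differing u s) → Reachable u s
    go u s u≡1 s≡1 (acc rec) with imbalancedTriangle u (ℕ.≤-reflexive (sym u≡1))
    ... | T , imbU with Fin.any? (λ a → differ? u s (side T a))
    ...   | yes (a , ≢) = star-reachable (m ◅ ε)
                            (go (flip (side T a) u) s (move-single m u≡1) s≡1 (rec (#differing-flip ≢)))
      where m = flipMove u (a , refl) imbU
    ...   | no same with Any.any? (differ? u s) edges
    ...     | no none = u , ε , λ e → decidable-stable (u e Sign.≟ s e) λ ≢ → none (lose (∈-edges e) ≢)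
    ...     | yes some with find some
    ...       | e , _ , ue≢se with triangleAt e (subst (0 <_) (sym (n≡2 e)) z<s)
    -- The path runs from `u` to `u′`, where a triangle at `e` is imbalanced, then crosses `e`,
    -- continues by recursion to `s′`, and follows `back` to `s`.
    ...         | X , e∈X = star-reachable (forth ◅◅ m ◅ ε) (reachable-star
                    (go (flip e u′) s′ (move-single m u′≡1) s′≡1 (rec decreases)) back)
      where
      -- No side of T distinguishes u from s.
      imbS : Imbalanced s T
      imbS = imbU ∘ trans (triangleSign-cong u s T λ a →
        decidable-stable (u (side T a) Sign.≟ s (side T a)) λ ≢ → same (a , ≢))
      open Conjugated (conjugate (connected T X) u s u≡1 s≡1 imbU imbS)
      m = flipMove u′ e∈X imbalanced-u′
      -- Conjugation keeps the disagreement at `e` and adds none; the flip then removes it.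
      decreases : #differing (flip e u′) s′ < #differing u s
      decreases = ℕ.<-≤-trans (#differing-flip (ue≢se ∘ Equivalence.to (agreement e)))
        (length-filter-mono (differ? u′ s′) (differ? u s)
          (λ {e′} ≢ eq → ≢ (Equivalence.from (agreement e′) eq)) edges)

theorem1 : (G : Graph) →
    Connected (T₃ G) →
    (∀ (e : Edge G) → #trianglesAt e ≤ 2) →
    (s₀ : State G) →
    ( (∃[ e ] #trianglesAt {G} e ≡ 1) →
    ∀ (s : State G) → Recurrent s₀ s ⇔ (CompletelyBalanced s × Reachable s₀ s) )
    ×
    ( (∀ (e : Edge G) → #trianglesAt e ≡ 2) →
    2 ∣ #imbalanced s₀ →
    ∀ (s : State G) → Recurrent s₀ s ⇔ (CompletelyBalanced s × Reachable s₀ s) )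
    ×
    ( (∀ (e : Edge G) → #trianglesAt e ≡ 2) →
    2 ∤ #imbalanced s₀ →
    ∀ (s : State G) →
    (Recurrent s₀ s ⇔ (#imbalanced s ≡ 1 × Reachable s₀ s)) ×
    (UnavoidablyRecurrent s₀ s ⇔ (#imbalanced s ≡ 1 × Reachable s₀ s)) )
theorem1 G connected n≤2 s₀ =
  (λ boundary → recurrent⇔completelyBalanced λ {x} _ →
    descend 0 (boundary⇒improve G connected n≤2 boundary) x) ,
  -- Descent leaves at most one imbalance, and even parity excludes exactly one.
  (λ n≡2 even → recurrent⇔completelyBalanced λ {x} p →
    let b , q , b≤1 = descendTo1 x in
    b , q , even∧≤1⇒≤0 (star-even n≡2 (p ◅◅ q) even) b≤1) ,
  λ n≡2 odd s →
    let single : ∀ x → 2 ∤ #imbalanced x → ∃[ u ] (Star Move x u × #imbalanced u ≡ 1)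
        single = λ x odd′ → let u , q , u≤1 = descendTo1 x in
          u , q , odd∧≤1⇒≡1 (star-odd n≡2 q odd′) u≤1

        recurrent⇒single : Recurrent s₀ s → #imbalanced s ≡ 1 × Reachable s₀ s
        recurrent⇒single rec =
          let x , p , _ , returns = recurrent⇒returns rec
              u , q , u≡1 = single x (star-odd n≡2 p odd)
          in reachable-single n≡2 (returns q) u≡1 , proj₁ rec

        single⇒unavoidable : #imbalanced s ≡ 1 × Reachable s₀ s → UnavoidablyRecurrent s₀ s
        -- Oddness persists along the path, so a single imbalance can be reached from `π n`, and
        -- from there every state with a single imbalance.
        single⇒unavoidable = λ (s≡1 , _) π path n →
          let u , q , u≡1 = single (π n) (infinitePath-odd n≡2 path odd n)
          in star-reachable q (single-reachable n≡2 connected u s u≡1 s≡1)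

        unavoidable⇒recurrent : UnavoidablyRecurrent s₀ s → Recurrent s₀ s
        unavoidable⇒recurrent = λ unavoidable →
          -- Reachability from `s₀` is the instance at time 0 of some infinite path, here `run s₀`.
          unavoidable (run s₀) (run-infinitePath s₀) 0 , λ π path m n _ _ → unavoidable π path n
    in mk⇔ recurrent⇒single (unavoidable⇒recurrent ∘ single⇒unavoidable) ,
       mk⇔ (recurrent⇒single ∘ unavoidable⇒recurrent) single⇒unavoidable
  where
  descendTo1 : ∀ x → ∃[ u ] (Star Move x u × #imbalanced u ≤ 1)
  descendTo1 = descend 1 (pair⇒improve G connected n≤2)
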